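{- Let $G$ be a strongly connected digraph with $n\geq 2$ vertices. (1) If $G$ contains an $m$-wheel for some $m\geq 1$, then $G$ admits a boolean nilpotent function of class at most $2n-m+1$. (2) If $G$ has a loop, then $G$ admits a boolean nilpotent function of class at most $2n-1$.
   Context: Digraphs may have loops but no multiple arcs. For $m\geq 1$, the $m$-wheel $W_m$ is the digraph obtained from a directed cycle $C_m$ of length $m$ (for $m=1$, a single vertex with a loop) by adding a new vertex $v$ (the center) and an arc from $v$ to every vertex of $C_m$; $G$ contains an $m$-wheel if some subgraph of $G$ is isomorphic to $W_m$. A boolean function on $[n]$ is a map $f:\{0,1\}^n\to\{0,1\}^n$; its (unsigned) interaction graph has an arc $(j,i)$ iff $f_i$ depends essentially on $x_j$, i.e. $f_i(a)\neq f_i(b)$ for some $a,b$ differing only in coordinate $j$. $G$ admits $f$ if the interaction graph of $f$ equals $G$. $f$ is nilpotent if $f^k$ is constant for some $k\geq 0$ ($f^0=\mathrm{id}$); the least such $k$ is its class. -}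

module Defs where

open import Data.Bool using (Bool; true; false; T)
open import Data.Fin using (Fin; zero; suc; toℕ)
open import Data.Fin.Subset using (Subset; _∈_)
open import Data.Nat using (ℕ; suc; _≤_; _≡ᵇ_; _%_; NonZero)
open import Data.Product using (_×_; ∃-syntax)
open import Data.Vec using (Vec; lookup)
open import Function.Bundles using (_⇔_)
open import Function.Definitions using (Injective)
open import Relation.Binary.Construct.Closure.ReflexiveTransitive using (Star)
open import Relation.Binary.PropositionalEquality using (_≡_; _≢_)
import Function.Endo.Propositional as Endo

-- Adjacency matrix: loops are allowed, multiple arcs are not.
Digraph : ℕ → Set
Digraph n = Fin n → Fin n → Bool

-- (u , v) is an arc of G, directed from u to v.
Arc : ∀ {n} → Digraph n → Fin n → Fin n → Set
Arc G u v = T (G u v)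

StronglyConnected : ∀ {n} → Digraph n → Set
StronglyConnected G = ∀ u v → Star (Arc G) u v

HasLoop : ∀ {n} → Digraph n → Set
HasLoop G = ∃[ v ] Arc G v v

-- Not necessarily induced, not necessarily spanning.
record Subgraph {n : ℕ} (G : Digraph n) : Set where
  field
    vertices : Subset n
    arcs     : Digraph n
    arcs⊆G   : ∀ {u v} → Arc arcs u v → Arc G u v
    source∈  : ∀ {u v} → Arc arcs u v → u ∈ vertices
    target∈  : ∀ {u v} → Arc arcs u v → v ∈ vertices

record IsomorphicTo {k n : ℕ} (H : Digraph k) {G : Digraph n} (S : Subgraph G) : Set where
  open Subgraph S
  field
    φ         : Fin k → Fin n
    injective : Injective _≡_ _≡_ φ
    image     : ∀ v → v ∈ vertices ⇔ (∃[ h ] φ h ≡ v)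
    arcs⇔     : ∀ h h′ → Arc H h h′ ⇔ Arc arcs (φ h) (φ h′)

Contains : ∀ {k n} → Digraph n → Digraph k → Set
Contains G H = ∃[ S ] IsomorphicTo H {G} S

-- Arcs i → i + 1 mod m; a single loop when m = 1.
cycle : (m : ℕ) .{{_ : NonZero m}} → Digraph m
cycle m i j = toℕ j ≡ᵇ suc (toℕ i) % m

-- The center is zero and the vertices of the cycle are the successors.
wheel : (m : ℕ) .{{_ : NonZero m}} → Digraph (suc m)
wheel m zero    zero    = false
wheel m zero    (suc _) = true
wheel m (suc _) zero    = false
wheel m (suc i) (suc j) = cycle m i j

State : ℕ → Set
State n = Vec Bool n

BooleanFunction : ℕ → Set
BooleanFunction n = State n → State n

DifferOnlyAt : ∀ {n} → Fin n → State n → State n → Set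
DifferOnlyAt j a b = lookup a j ≢ lookup b j × (∀ k → k ≢ j → lookup a k ≡ lookup b k)

InteractionArc : ∀ {n} → BooleanFunction n → Fin n → Fin n → Set
InteractionArc f j i =
  ∃[ a ] ∃[ b ] (DifferOnlyAt j a b × lookup (f a) i ≢ lookup (f b) i)

Admits : ∀ {n} → Digraph n → BooleanFunction n → Set
Admits G f = ∀ j i → Arc G j i ⇔ InteractionArc f j i

IsConstant : ∀ {n} → BooleanFunction n → Set
IsConstant f = ∃[ c ] (∀ x → f x ≡ c)

-- The k-fold composition of f with itself, the identity for k = 0.
power : ∀ {n} → BooleanFunction n → ℕ → BooleanFunction n
power {n} = Endo._^_ (State n)

Nilpotent : ∀ {n} → BooleanFunction n → Set
Nilpotent f = ∃[ k ] IsConstant (power f k)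

HasClass : ∀ {n} → BooleanFunction n → ℕ → Set
HasClass f k = IsConstant (power f k) × (∀ l → IsConstant (power f l) → k ≤ l)

AdmitsNilpotentOfClass≤ : ∀ {n} → Digraph n → ℕ → Set
AdmitsNilpotentOfClass≤ G b =
  ∃[ f ] (Admits G f × Nilpotent f × ∃[ k ] (HasClass f k × k ≤ b))

{-# OPTIONS --safe #-}
module Submission where

-- The functions used are conjunctions of literals, one literal for each in-neighbour.
-- Let C be the cycle of the wheel and c its center (for a loop at v, let C = {v} and
-- c = v).  Grow a strongly connected vertex set S ⊇ C by ears until one last ear,
-- with last vertex a, covers the remaining vertices; let H consist of the arcs from
-- S ∪ {a} to S together with the arcs of this ear.
--
-- If some arc is not in H, exactly the arcs outside H are negative.  If H = G, exactly
-- the arcs leaving a are negative.  In both cases every vertex is reached from C by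
-- positive arcs, so once C is extinct everything is extinct n − m steps later.  If C
-- stays alive for a long time, a true value runs around C and forces c to be
-- constantly true, hence so is everything from which c is reached by positive arcs;
-- this contradicts an arc outside H, or, when H = G, the fact that the ear merely
-- delays a true value before it reaches a.  When c = a, the center is instead forced
-- to be constantly false, while a true value of C eventually arrives there.

open import Defs
open import Data.Bool using (Bool; true; false; not)
open import Data.Bool.Properties using (T?; not-¬; ¬-not) renaming (_≟_ to _≟ᵇ_)
open import Data.Empty using (⊥)
open import Data.Fin using (Fin; zero; suc; toℕ)
open import Data.Fin.Properties using (_≟_; all?; ¬∀⟶∃¬; injective⇒≤; suc-injective; toℕ-fromℕ<; toℕ-injective; toℕ<n)
open import Data.Fin.Subset.Properties using (anySubset?)
open import Data.List using (List; []; _∷_; [_]; _++_; length; drop; map; allFin)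
import Data.List as List
open import Data.List.Membership.DecPropositional using (_∈?_)
open import Data.List.Membership.Propositional using (_∈_; _∉_)
open import Data.List.Membership.Propositional.Properties using (∈-lookup; ∈-++⁺ˡ; ∈-++⁺ʳ; ∈-++⁻; ∈-map⁺; ∈-map⁻; ∈-allFin)
open import Data.List.Properties using (length-++; length-map; length-tabulate)
open import Data.List.Relation.Unary.All as All using ([]; _∷_)
open import Data.List.Relation.Unary.All.Properties using (¬Any⇒All¬)
open import Data.List.Relation.Unary.Any using (here; there)
open import Data.List.Relation.Unary.AllPairs using ([]; _∷_)
open import Data.List.Relation.Unary.Unique.Propositional using (Unique)
open import Data.List.Relation.Unary.Unique.Propositional.Properties using (++⁺; map⁺; allFin⁺)
open import Data.Nat using (ℕ; zero; suc; _≤_; _<_; z≤n; s≤s; _+_; _*_; _∸_; _/_; _%_; NonZero)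
open import Data.Nat.DivMod using (_mod_; m%n<n; m≡m%n+[m/n]*n; [m+kn]%n≡m%n; %-distribˡ-+; m%n%n≡m%n; m<n⇒m%n≡m)
open import Data.Nat.Properties hiding (_≟_; suc-injective)
open import Data.Nat.Solver using (module +-*-Solver)
open import Data.Product using (_×_; _,_; proj₁; proj₂; ∃-syntax)
open import Data.Product.Properties using (≡-dec)
open import Data.Sum using (_⊎_; inj₁; inj₂; [_,_]′)
open import Data.Vec using (lookup; tabulate; replicate; updateAt)
open import Data.Vec.Properties using (lookup∘tabulate; tabulate∘lookup; tabulate-cong; lookup∘updateAt; lookup∘updateAt′) renaming (≡-dec to ≡-decᵛ)
open import Function using (_∘_; flip; id; mk⇔)
open import Function.Bundles using (Equivalence)
open import Relation.Binary.Construct.Closure.ReflexiveTransitive as Star using (Star; ε; _◅_; _◅◅_)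
open import Relation.Binary.PropositionalEquality using (_≡_; _≢_; refl; sym; trans; cong; subst; module ≡-Reasoning)
open import Relation.Nullary using (¬_; Dec; yes; no; does; contradiction; ¬?)
open import Relation.Nullary.Decidable using (toSum; dec-true; dec-false; decidable-stable; _×-dec_; _⊎-dec_; _→-dec_)

private variable
  n : ℕ

-- Vertex sets as lists without repetition

lookup-injective : ∀ {A : Set} {xs : List A} → Unique xs → ∀ i j → List.lookup xs i ≡ List.lookup xs j → i ≡ j
lookup-injective (_ ∷ _)  zero    zero    _  = refl
lookup-injective (x ∷ _)  zero    (suc j) eq = contradiction eq (All.lookup x (∈-lookup j))
lookup-injective (x ∷ _)  (suc i) zero    eq = contradiction (sym eq) (All.lookup x (∈-lookup i))
lookup-injective (_ ∷ xs) (suc i) (suc j) eq = cong suc (lookup-injective xs i j eq)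

length-unique : {xs : List (Fin n)} → Unique xs → length xs ≤ n
length-unique u = injective⇒≤ (lookup-injective u _ _)

∉⇒unique : {x : Fin n} {xs : List (Fin n)} → x ∉ xs → Unique xs → Unique (x ∷ xs)
∉⇒unique x∉xs u = ¬Any⇒All¬ _ x∉xs ∷ u

-- Every travel time below is bounded by this count: the vertices met on the way are distinct and
-- avoid a given set.
length-++-unique : {xs ys : List (Fin n)} → Unique xs → Unique ys →
  (∀ {v} → v ∈ xs → v ∉ ys) → length xs + length ys ≤ n
length-++-unique {xs = xs} u v d =
  subst (_≤ _) (length-++ xs) (length-unique (++⁺ u v (λ (p , q) → d p q)))

-- Classes

leastUpTo : {P : ℕ → Set} → (∀ k → Dec (P k)) → ∀ b → P b →
  ∃[ k ] (P k × (∀ l → P l → k ≤ l)) × k ≤ b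
leastUpTo P? zero    pb = zero , (pb , λ _ _ → z≤n) , z≤n
leastUpTo {P} P? (suc b) pb with P? 0
... | yes p0 = zero , (p0 , λ _ _ → z≤n) , z≤n
... | no ¬p0 =
  let (k , (pk , least) , k≤b) = leastUpTo (P? ∘ suc) b pb in
  suc k , (pk , λ { zero p0 → contradiction p0 ¬p0 ; (suc l) pl → s≤s (least l pl) }) , s≤s k≤b

isConstant? : (f : BooleanFunction n) → Dec (IsConstant f)
-- `Subset n` and `State n` are both `Vec Bool n`, so the search over subsets runs over all states.
-- The all-false state supplies the reference value.
isConstant? {n} f with anySubset? (λ x → ¬? (≡-decᵛ _≟ᵇ_ (f x) (f (replicate n false))))
... | yes (x , ≢) = no λ (c , const) → ≢ (trans (const x) (sym (const _)))
... | no ¬∃ = yes (_ , λ x → decidable-stable (≡-decᵛ _≟ᵇ_ _ _) (λ ≢ → ¬∃ (x , ≢)))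

extinct⇒nilpotent : {G : Digraph n} (f : BooleanFunction n) → Admits G f → ∀ b →
  (∀ x u → lookup (power f b x) u ≡ false) → AdmitsNilpotentOfClass≤ G b
extinct⇒nilpotent f adm b extinct = f , adm , (b , const) , leastUpTo (isConstant? ∘ power f) b const
  where
  const : IsConstant (power f b)
  const = _ , λ x → trans (sym (tabulate∘lookup _)) (tabulate-cong (extinct x))

-- Conjunctive networks

-- `sign j i` is the value that `i` demands of its in-neighbour `j`: `true` for a positive literal,
-- `false` for a negated one.
module Network (G sign : Digraph n) where

  Fires : State n → Fin n → Set
  Fires x i = ∀ j → Arc G j i → lookup x j ≡ sign j i

  fires? : ∀ x i → Dec (Fires x i)
  fires? x i = all? λ j → T? (G j i) →-dec (lookup x j ≟ᵇ sign j i)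

  net : BooleanFunction n
  net x = tabulate λ i → does (fires? x i)

  net-true : ∀ x i → Fires x i → lookup (net x) i ≡ true
  net-true x i h = trans (lookup∘tabulate _ i) (dec-true (fires? x i) h)

  net-false : ∀ x i → ¬ Fires x i → lookup (net x) i ≡ false
  net-false x i h = trans (lookup∘tabulate _ i) (dec-false (fires? x i) h)

  net-true⁻ : ∀ x i → lookup (net x) i ≡ true → Fires x i
  net-true⁻ x i eq with fires? x i
  ... | yes f = f
  ... | no ¬f = contradiction (trans (sym eq) (net-false x i ¬f)) λ ()

  net-cong : ∀ x y i → (∀ j → Arc G j i → lookup x j ≡ lookup y j) → lookup (net x) i ≡ lookup (net y) i
  net-cong x y i eq with fires? x i
  ... | yes f = trans (net-true x i f) (sym (net-true y i λ j a → trans (sym (eq j a)) (f j a)))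
  ... | no ¬f = trans (net-false x i ¬f) (sym (net-false y i λ f → ¬f λ j a → trans (eq j a) (f j a)))

  net-admits : Admits G net
  net-admits j i = mk⇔ to from
    where
    to : Arc G j i → InteractionArc net j i
    -- The state `a` satisfies every literal of `i`; flipping coordinate `j` violates the literal of
    -- `j`.
    to arc = a , b , (flipped , kept) , λ eq → flipped
      (trans (lookup∘tabulate _ j) (sym (net-true⁻ b i (trans (sym eq) (net-true a i fires)) j arc)))
      where
      a b : State n
      a = tabulate λ k → sign k i
      b = updateAt a j not
      fires : Fires a i
      fires k _ = lookup∘tabulate _ k
      flipped : lookup a j ≢ lookup b j
      flipped eq = not-¬ refl (trans eq (lookup∘updateAt j a))
      kept : ∀ k → k ≢ j → lookup a k ≡ lookup b k
      kept k k≢j = sym (lookup∘updateAt′ k j k≢j a)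
    from : InteractionArc net j i → Arc G j i
    from (a , b , (_ , kept) , ≢) with T? (G j i)
    ... | yes arc = arc
    ... | no ¬arc = contradiction (net-cong a b i λ k arc → kept k λ { refl → ¬arc arc }) ≢

  module Trajectory (x : State n) where

    at : ℕ → Fin n → Bool
    at t = lookup (power net t x)

    fire⁻ : ∀ t {i j} → at (suc t) i ≡ true → Arc G j i → at t j ≡ sign j i
    fire⁻ t h arc = net-true⁻ (power net t x) _ h _ arc

    fire : ∀ t {i} → (∀ j → Arc G j i → at t j ≡ sign j i) → at (suc t) i ≡ true
    fire t = net-true (power net t x) _

-- Simple paths

-- A simple R-path from a vertex to S, stopped when it meets S; the list consists of
-- its vertices outside S.
data Path (R : Fin n → Fin n → Set) (S : List (Fin n)) : Fin n → List (Fin n) → Set where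
  stop : ∀ {x} → x ∈ S → Path R S x []
  step : ∀ {x y xs} → x ∉ S → x ∉ xs → R x y → Path R S y xs → Path R S x (x ∷ xs)

module _ {R : Fin n → Fin n → Set} {S : List (Fin n)} where

  -- Loop erasure for `path`: a walk that returns to `x` is replaced by the rest of the path from
  -- there.
  suffix : ∀ {x y xs} → x ∈ xs → Path R S y xs → ∃[ ys ] Path R S x ys
  suffix (here refl) p@(step _ _ _ _) = _ , p
  suffix (there i)   (step _ _ _ p)   = suffix i p

  path : ∀ {x y} → Star R x y → y ∈ S → ∃[ xs ] Path R S x xs
  path ε y∈S = [] , stop y∈S
  path {x} (r ◅ rs) y∈S with _∈?_ _≟_ x S | path rs y∈S
  ... | yes x∈S | _ = [] , stop x∈S
  ... | no x∉S | xs , p with _∈?_ _≟_ x xs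
  ...   | yes x∈xs = suffix x∈xs p
  ...   | no x∉xs  = x ∷ xs , step x∉S x∉xs r p

  path-unique : ∀ {x xs} → Path R S x xs → Unique xs
  path-unique (stop _)         = []
  path-unique (step _ x∉ _ p) = ∉⇒unique x∉ (path-unique p)

  path-∉ : ∀ {x v xs} → Path R S x xs → v ∈ xs → v ∉ S
  path-∉ (step x∉S _ _ _) (here refl) = x∉S
  path-∉ (step _ _ _ p)   (there i)   = path-∉ p i

  path-start : ∀ {x xs} → Path R S x xs → x ∈ S ⊎ x ∈ xs
  path-start (stop x∈S)     = inj₁ x∈S
  path-start (step _ _ _ _) = inj₂ (here refl)

  path-sources : {P : Fin n → Set} → (∀ {j i} → R j i → P j) → ∀ {x v xs} → Path R S x xs → v ∈ xs → P v
  path-sources src (step _ _ r _) (here refl) = src r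
  path-sources src (step _ _ _ p) (there i)   = path-sources src p i

  length-path : ∀ {x xs} → Unique S → Path R S x xs → length xs + length S ≤ n
  length-path u p = length-++-unique (path-unique p) u (path-∉ p)

  base : ∀ {x xs} → Path R S x xs → ∃[ u ] u ∈ S
  base (stop x∈S)     = _ , x∈S
  base (step _ _ _ p) = base p

entering : {R : Fin n → Fin n → Set} (S : List (Fin n)) → ∀ {x y} → Star R x y → x ∉ S → y ∈ S →
  ∃[ a ] ∃[ w ] (a ∉ S × w ∈ S × R a w)
entering S ε x∉S y∈S = contradiction y∈S x∉S
entering S (_◅_ {j = z} r rs) x∉S y∈S with _∈?_ _≟_ z S
... | yes z∈S = _ , _ , x∉S , z∈S , r
... | no z∉S  = entering S rs z∉S y∈S

-- Ears, traversed backwards from their last vertex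

module Ear (G : Digraph n) (S : List (Fin n)) where

  BackPath : Fin n → List (Fin n) → Set
  BackPath = Path (flip (Arc G)) S

  arcs : ∀ {x xs} → BackPath x xs → List (Fin n × Fin n)
  arcs (stop _)                     = []
  arcs (step {x = x} {y = y} _ _ _ p) = (y , x) ∷ arcs p

  OnEar : ∀ {x xs} → BackPath x xs → Fin n → Fin n → Set
  OnEar p j i = (j , i) ∈ arcs p

  onEar⇒arc : ∀ {x xs} (p : BackPath x xs) {j i} → OnEar p j i → Arc G j i
  onEar⇒arc (step _ _ r _) (here refl) = r
  onEar⇒arc (step _ _ _ p) (there e)   = onEar⇒arc p e

  target : ∀ {x xs} (p : BackPath x xs) {j i} → OnEar p j i → i ∈ xs
  target (step _ _ _ _) (here refl) = here refl
  target (step _ _ _ p) (there e)   = there (target p e)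

  -- `drop 1` discards the last vertex of the ear, which heads the backward list: no arc of the ear
  -- leaves it.
  source : ∀ {x xs} (p : BackPath x xs) {j i} → OnEar p j i → j ∈ S ⊎ j ∈ drop 1 xs
  source (step _ _ _ p) (here refl) = path-start p
  source (step _ _ _ p@(step _ _ _ _)) (there e) = [ inj₁ , inj₂ ∘ there ]′ (source p e)

  toEnd : ∀ {x v xs} (p : BackPath x xs) → v ∈ xs → Star (OnEar p) v x
  toEnd (step _ _ _ p) (here refl) = ε
  toEnd (step _ _ _ p) (there i)   = Star.map there (toEnd p i) ◅◅ (here refl ◅ ε)

  fromBase : ∀ {x xs} (p : BackPath x xs) → Star (OnEar p) (proj₁ (base p)) x
  fromBase (stop _)       = ε
  fromBase (step _ _ _ p) = Star.map there (fromBase p) ◅◅ (here refl ◅ ε)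

  fromBaseTo : ∀ {x v xs} (p : BackPath x xs) → v ∈ xs → Star (OnEar p) (proj₁ (base p)) v
  fromBaseTo p@(step _ _ _ _) (here refl) = fromBase p
  fromBaseTo (step _ _ _ p)   (there i)   = Star.map there (fromBaseTo p i)

-- Propagation of truth values along paths

module _ (G sign : Digraph n) (x : State n) where

  open Network G sign
  open Trajectory x

  -- A conjunction is true only if its positive literals were true one step earlier, so each arc of
  -- the path to `c` costs one unit of time.
  upstream-true : ∀ {R : Fin n → Fin n → Set} {c b u us} → (∀ {j i} → R j i → Arc G j i × sign j i ≡ true) →
    (∀ t → t ≤ b → at t c ≡ true) → Path R [ c ] u us → ∀ t → t + length us ≤ b → at t u ≡ true
  upstream-true pos c-true (stop (here refl)) t le = c-true t (subst (_≤ _) (+-identityʳ t) le)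
  upstream-true {b = b} pos c-true (step {xs = us} _ _ r p) t le =
    let (arc , positive) = pos r in
    trans (fire⁻ t (upstream-true pos c-true p (suc t) (subst (_≤ b) (+-suc t (length us)) le)) arc) positive

  -- One false positive literal makes a conjunction false, so extinction advances one arc per step.
  -- The path is read from `u` back to `C`.
  downstream-false : ∀ {R : Fin n → Fin n → Set} {C N u us} → (∀ {j i} → R j i → Arc G j i × sign j i ≡ true) →
    (∀ t → N ≤ t → ∀ {v} → v ∈ C → at t v ≡ false) → Path (flip R) C u us → ∀ t → N + length us ≤ t → at t u ≡ false
  downstream-false pos C-false (stop u∈C) t le = C-false t (subst (_≤ _) (+-identityʳ _) le) u∈C
  downstream-false {N = N} pos C-false (step {xs = us} _ _ r p) t le
    with t | subst (_≤ t) (+-suc N (length us)) le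
  ... | suc t | s≤s le′ = ¬-not λ u-true →
    let (arc , positive) = pos r in
    contradiction (trans (sym (trans (fire⁻ t u-true arc) positive)) (downstream-false pos C-false p t le′)) λ ()

  open Ear G

  -- By `only` and simplicity, the sole in-neighbour of an ear vertex is its predecessor on the ear,
  -- whose value it copies one step later.
  ear-delays : ∀ {S v vs} (p : BackPath S v vs) → (∀ {j i} → OnEar S p j i → sign j i ≡ true) →
    (∀ {j i} → i ∈ vs → Arc G j i → OnEar S p j i) →
    ∀ t → at t (proj₁ (base p)) ≡ true → at (t + length vs) v ≡ true
  ear-delays (stop _) pos only t h = subst (λ s → at s _ ≡ true) (sym (+-identityʳ t)) h
  ear-delays {S} (step {x = v} {xs = vs} _ v∉vs r p) pos only t h =
    subst (λ s → at s v ≡ true) (sym (+-suc t (length vs))) (fire (t + length vs) input)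
    where
    only′ : ∀ {j i} → i ∈ vs → Arc G j i → OnEar S p j i
    only′ i∈vs arc with only (there i∈vs) arc
    ... | here refl = contradiction i∈vs v∉vs
    ... | there e   = e
    input : ∀ j → Arc G j v → at (t + length vs) j ≡ sign j v
    input j arc with only (here refl) arc
    ... | here refl = trans (ear-delays p (pos ∘ there) only′ t h) (sym (pos (here refl)))
    ... | there e   = contradiction (target S p e) v∉vs

-- The hub may lie on the cycle, as it does in the case of a loop; pos q is the q-th
-- vertex of the closed walk that runs around the cycle forever.
record Rim (G : Digraph n) (m : ℕ) : Set where
  field
    rim        : List (Fin n)
    rim-unique : Unique rim
    rim-length : length rim ≡ m
    pos        : ℕ → Fin n
    pos∈rim    : ∀ q → pos q ∈ rim
    pos-arc    : ∀ q → Arc G (pos q) (pos (suc q))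
    pos-hits   : ∀ p {v} → v ∈ rim → ∃[ t ] (t < m × pos (p + t) ≡ v)
    hub        : Fin n
    spoke      : ∀ q → Arc G hub (pos q)

-- Growth by ears and the choice of signs

module Construction (G : Digraph n) (connected : StronglyConnected G) {m} (W : Rim G m)
  -- Survival of the rim up to time `N` will be contradicted. Reading the hub through a spoke costs
  -- one step, hence `suc n`; at a loop the hub is the rim and this step is saved.
  (N : ℕ) (timing : N ≡ suc n ⊎ (N ≡ n × (∀ q → Rim.pos W q ≡ Rim.hub W))) where

  open Rim W

  Goal : Set
  Goal = AdmitsNilpotentOfClass≤ G (N + (n ∸ m))

  module Extinction (sign : Digraph n) (rim-positive : ∀ q → sign (pos q) (pos (suc q)) ≡ true) where

    open Network G sign

    Alive : State n → ℕ → Set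
    Alive x p = ∀ t → t ≤ N → Trajectory.at x t (pos (p + t)) ≡ true

    module _ (x : State n) where

      open Trajectory x

      backtrack : ∀ q t → at t (pos (q + t)) ≡ true → ∀ s → s ≤ t → at s (pos (q + s)) ≡ true
      backtrack q zero    h zero z≤n = h
      backtrack q (suc t) h s s≤ with m≤n⇒m<n∨m≡n s≤
      ... | inj₂ refl      = h
      ... | inj₁ (s≤s s≤t) = backtrack q t
        (trans (fire⁻ t (subst (λ r → at (suc t) (pos r) ≡ true) (+-suc q t) h) (pos-arc (q + t))) (rim-positive (q + t)))
        s s≤t

      -- A true rim vertex at time `t` traces back around the rim to time 0, and `N ≤ t` makes this
      -- trace long enough to be `Alive`.
      rim-extinct : (∀ p → ¬ Alive x p) → ∀ t → N ≤ t → ∀ {v} → v ∈ rim → at t v ≡ false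
      rim-extinct ¬alive t N≤t v∈rim = ¬-not λ h →
        -- `p` is chosen so that the walk starting at `pos p` stands on the given vertex at time
        -- `t`.
        let (p , _ , eq) = pos-hits t v∈rim
            start = subst (λ u → at t u ≡ true) (trans (sym eq) (cong pos (+-comm t p))) h
        in ¬alive p λ s s≤N → backtrack p t start s (≤-trans s≤N N≤t)

      hub-true : (∀ q → sign hub (pos q) ≡ true) → ∀ p → Alive x p → ∀ t → t ≤ n → at t hub ≡ true
      hub-true positive p alive t t≤n =
        [ (λ N≡1+n → trans (fire⁻ t (alive (suc t) (subst (t <_) (sym N≡1+n) (s≤s t≤n))) (spoke _)) (positive _))
        , (λ (N≡n , pos≡hub) → subst (λ u → at t u ≡ true) (pos≡hub _) (alive t (subst (t ≤_) (sym N≡n) t≤n)))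
        ]′ timing

    -- A simple path leaving the rim has at most `n ∸ m` vertices outside it; this is the delay
    -- between extinction of the rim and of everything.
    conclude : {R : Fin n → Fin n → Set} → (∀ {j i} → R j i → Arc G j i × sign j i ≡ true) →
      (∀ u → Star R (pos 0) u) → (∀ x p → ¬ Alive x p) → Goal
    conclude {R} positive reach ¬alive = extinct⇒nilpotent net net-admits (N + (n ∸ m)) λ x u →
      let (us , p) = path {R = flip R} (Star.reverse id (reach u)) (pos∈rim 0)
          bound = m+n≤o⇒m≤o∸n (length us) (subst (λ l → length us + l ≤ n) rim-length (length-path rim-unique p))
      in downstream-false G sign x positive (rim-extinct x (¬alive x)) p _ (+-monoʳ-≤ N bound)

  Within : List (Fin n) → Fin n → Fin n → Set
  Within S j i = Arc G j i × j ∈ S × i ∈ S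

  -- The vertex `a` and its arc to `w` are set aside as the way back into `S` for the next ear.
  record Stage (S : List (Fin n)) (a : Fin n) : Set where
    field
      unique : Unique S
      rim⊆S  : ∀ {v} → v ∈ rim → v ∈ S
      strong : ∀ {s s′} → s ∈ S → s′ ∈ S → Star (Within S) s s′
      a∉S    : a ∉ S
      w      : Fin n
      w∈S    : w ∈ S
      exit   : Arc G a w
      -- The second alternative is the start for a wheel: `S` is the rim and the first ear ends at
      -- the hub.
      centre : hub ∈ S ⊎ (hub ≡ a × (∀ {v} → v ∈ S → v ∈ rim))

  module AddEar {S a} (st : Stage S a) {xs} (ear : Ear.BackPath G S a xs) where

    open Stage st
    open Ear G S

    S′ : List (Fin n)
    S′ = xs ++ S

    -- All arcs from `a` to `S` are included, not only `exit`: when the hub is `a`, they contain the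
    -- spokes.
    H : Fin n → Fin n → Set
    H j i = (i ∈ S × (j ∈ S ⊎ j ≡ a)) ⊎ OnEar ear j i

    H? : ∀ j i → Dec (H j i)
    H? j i = (_∈?_ _≟_ i S ×-dec (_∈?_ _≟_ j S ⊎-dec (j ≟ a))) ⊎-dec _∈?_ (≡-dec _≟_ _≟_) (j , i) (arcs ear)

    HArc : Fin n → Fin n → Set
    HArc j i = Arc G j i × H j i

    a∈xs : a ∈ xs
    a∈xs = [ flip contradiction a∉S , id ]′ (path-start ear)

    unique′ : Unique S′
    unique′ = ++⁺ (path-unique ear) unique λ (p , q) → path-∉ ear p q

    a∉rest : a ∉ drop 1 xs
    a∉rest = go ear
      where
      go : ∀ {y ys} → BackPath y ys → y ∉ drop 1 ys
      go (stop _) ()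
      go (step _ y∉ _ _) = y∉

    source≢a : ∀ {j i} → OnEar ear j i → j ≢ a
    source≢a e refl = [ a∉S , a∉rest ]′ (source ear e)

    within⇒HArc : ∀ {j i} → Within S j i → HArc j i
    within⇒HArc (arc , j∈S , i∈S) = arc , inj₁ (i∈S , inj₁ j∈S)

    onEar⇒HArc : ∀ {j i} → OnEar ear j i → HArc j i
    onEar⇒HArc e = onEar⇒arc ear e , inj₂ e

    H⇒∈S′ : ∀ {j i} → H j i → j ∈ S′ × i ∈ S′
    H⇒∈S′ (inj₁ (i∈S , inj₁ j∈S))  = ∈-++⁺ʳ xs j∈S , ∈-++⁺ʳ xs i∈S
    H⇒∈S′ (inj₁ (i∈S , inj₂ refl)) = ∈-++⁺ˡ a∈xs , ∈-++⁺ʳ xs i∈S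
    H⇒∈S′ (inj₂ e) = src (source ear e) , ∈-++⁺ˡ (target ear e)
      where
      drop⊆ : ∀ {v} (ys : List (Fin n)) → v ∈ drop 1 ys → v ∈ ys
      drop⊆ (_ ∷ _) = there
      src : ∀ {j} → j ∈ S ⊎ j ∈ drop 1 xs → j ∈ S′
      src = [ ∈-++⁺ʳ xs , ∈-++⁺ˡ ∘ drop⊆ xs ]′

    toS : ∀ {v} → v ∈ S′ → ∃[ s ] (s ∈ S × Star HArc v s)
    toS {v} v∈ with ∈-++⁻ xs v∈
    ... | inj₂ v∈S  = v , v∈S , ε
    ... | inj₁ v∈xs = w , w∈S ,
      Star.map onEar⇒HArc (toEnd ear v∈xs) ◅◅ ((exit , inj₁ (w∈S , inj₂ refl)) ◅ ε)

    fromS : ∀ {v} → v ∈ S′ → ∃[ s ] (s ∈ S × Star HArc s v)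
    fromS {v} v∈ with ∈-++⁻ xs v∈
    ... | inj₂ v∈S  = v , v∈S , ε
    ... | inj₁ v∈xs = _ , proj₂ (base ear) , Star.map onEar⇒HArc (fromBaseTo ear v∈xs)

    -- Follow the ear to `a`, take `exit` into `S`, cross `S`, and enter the ear again at its base.
    H-strong : ∀ {u v} → u ∈ S′ → v ∈ S′ → Star HArc u v
    H-strong u∈ v∈ =
      let (_ , s∈ , u⇝s) = toS u∈
          (_ , t∈ , t⇝v) = fromS v∈
      in u⇝s ◅◅ Star.map within⇒HArc (strong s∈ t∈) ◅◅ t⇝v

    strong′ : ∀ {u v} → u ∈ S′ → v ∈ S′ → Star (Within S′) u v
    strong′ u∈ v∈ = Star.map (λ (arc , h) → arc , H⇒∈S′ h) (H-strong u∈ v∈)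

    hub∈S′ : hub ∈ S′
    hub∈S′ = [ ∈-++⁺ʳ xs , (λ (hub≡a , _) → ∈-++⁺ˡ (subst (_∈ xs) (sym hub≡a) a∈xs)) ]′ centre

    pos∈S : ∀ q → pos q ∈ S
    pos∈S q = rim⊆S (pos∈rim q)

    spoke∈H : ∀ q → H hub (pos q)
    spoke∈H q = inj₁ (pos∈S q , [ inj₁ , inj₂ ∘ proj₁ ]′ centre)

    module Spanning (covers : ∀ v → v ∈ S′) where

      -- If the rim survived, every vertex would be true at times 0 and 1, which a negative arc
      -- forbids; so no arc could lie outside `H`.
      extra-arc : ¬ (∀ j i → Arc G j i → H j i) → Goal
      extra-arc ¬G⊆H = conclude positive (λ u → H-strong (covers _) (covers u)) ¬alive
        where
        sign : Digraph n
        sign j i = does (H? j i)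
        sign-H : ∀ {j i} → H j i → sign j i ≡ true
        sign-H = dec-true (H? _ _)
        positive : ∀ {j i} → HArc j i → Arc G j i × sign j i ≡ true
        positive (arc , h) = arc , sign-H h
        open Extinction sign (λ q → sign-H (inj₁ (pos∈S (suc q) , inj₁ (pos∈S q))))
        ¬alive : ∀ x p → ¬ Alive x p
        ¬alive x p alive = ¬G⊆H λ j i arc → decidable-stable (H? j i) λ ¬h →
          contradiction
            (trans (sym (all-true 0 z≤n j)) (trans (fire⁻ 0 (all-true 1 ≤-refl i) arc) (dec-false (H? j i) ¬h)))
            λ ()
          where
          open Network.Trajectory G sign x
          all-true : ∀ t → t ≤ 1 → ∀ u → at t u ≡ true
          all-true t t≤1 u =
            -- A simple path to the hub has at most `n ∸ 1` arcs and the hub is true up to time `n`,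
            -- which leaves times 0 and 1.
            let (us , p′) = path {S = [ hub ]} (H-strong (covers u) (covers hub)) (here refl)
            in upstream-true G sign x positive (hub-true x (sign-H ∘ spoke∈H) p alive) p′ t
                 (≤-trans (+-monoˡ-≤ (length us) t≤1)
                   (subst (_≤ n) (+-comm (length us) 1) (length-path ([] ∷ []) p′)))

      -- As `G` has only the arcs of `H`, the ear is a pure delay line. What it delivers to `a`
      -- clashes with the negative arcs leaving `a`.
      last-ear : (∀ j i → Arc G j i → H j i) → Goal
      last-ear G⊆H = conclude positive reach ¬alive
        where
        sign : Digraph n
        sign j i = not (does (j ≟ a))
        sign-true : ∀ {j i} → j ≢ a → sign j i ≡ true
        sign-true j≢a = cong not (dec-false (_ ≟ a) j≢a)
        sign-false : ∀ i → sign a i ≡ false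
        sign-false i = cong not (dec-true (a ≟ a) refl)
        S≢a : ∀ {s} → s ∈ S → s ≢ a
        S≢a s∈S refl = a∉S s∈S
        Positive : Fin n → Fin n → Set
        Positive j i = Arc G j i × j ≢ a
        positive : ∀ {j i} → Positive j i → Arc G j i × sign j i ≡ true
        positive {i = i} (arc , j≢a) = arc , sign-true {i = i} j≢a
        within-positive : ∀ {j i} → Within S j i → Arc G j i × sign j i ≡ true
        within-positive {i = i} (arc , j∈S , _) = arc , sign-true {i = i} (S≢a j∈S)
        inS : ∀ {s s′} → s ∈ S → s′ ∈ S → Star Positive s s′
        inS s∈ s′∈ = Star.map (λ (arc , j∈S , _) → arc , S≢a j∈S) (strong s∈ s′∈)
        reach : ∀ u → Star Positive (pos 0) u
        reach u with ∈-++⁻ xs (covers u)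
        ... | inj₂ u∈S  = inS (pos∈S 0) u∈S
        ... | inj₁ u∈xs = inS (pos∈S 0) (proj₂ (base ear)) ◅◅
          Star.map (λ e → onEar⇒arc ear e , source≢a e) (fromBaseTo ear u∈xs)
        only : ∀ {j i} → i ∈ xs → Arc G j i → OnEar ear j i
        only {j} {i} i∈xs arc = [ (λ (i∈S , _) → contradiction i∈S (path-∉ ear i∈xs)) , id ]′ (G⊆H j i arc)
        open Extinction sign (λ q → sign-true {i = pos (suc q)} (S≢a (pos∈S q)))
        ¬alive : ∀ x p → ¬ Alive x p
        ¬alive x p alive = [ hub-in-S , hub-is-a ]′ centre
          where
          open Network.Trajectory G sign x
          delayed : ∀ t → at t (proj₁ (base ear)) ≡ true → at (t + length xs) a ≡ true
          delayed = ear-delays G sign x ear (λ {_} {i} e → sign-true {i = i} (source≢a e)) only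
          hub-in-S : hub ∈ S → ⊥
          -- The base, true at time 0, makes `a` true at time `length xs`; but `w` is true one step
          -- later and, through the negative arc `exit`, needs `a` false.
          hub-in-S hub∈S = contradiction
            (trans (sym (delayed 0 base-true)) (trans (fire⁻ (length xs) w-true exit) (sign-false w))) λ ()
            where
            S-true : ∀ {u us} → Path (Within S) [ hub ] u us → ∀ t → t + length us ≤ n → at t u ≡ true
            S-true = upstream-true G sign x within-positive
              (hub-true x (λ q → sign-true {i = pos q} (S≢a hub∈S)) p alive)
            base-true : at 0 (proj₁ (base ear)) ≡ true
            base-true =
              let (_ , p′) = path {S = [ hub ]} (strong (proj₂ (base ear)) hub∈S) (here refl)
              in S-true p′ 0 (m+n≤o⇒m≤o _ (length-path ([] ∷ []) p′))
            w-true : at (suc (length xs)) w ≡ true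
            w-true =
              let (ys , p′) = path {S = [ hub ]} (strong w∈S hub∈S) (here refl)
                  ys⊆S : ∀ {v} → v ∈ ys → v ∈ S
                  ys⊆S = path-sources {P = _∈ S} (λ (_ , j∈S , _) → j∈S) p′
                  hub∉ys = λ hub∈ys → path-∉ p′ hub∈ys (here refl)
              -- The ear, the hub and the path `ys` inside `S` are disjoint, so
              -- `suc (length xs) + length ys` is at most `n`.
              in S-true p′ (suc (length xs))
                   (subst (_≤ n) (+-suc (length xs) (length ys))
                     (length-++-unique (path-unique ear) (∉⇒unique hub∉ys (path-unique p′))
                       λ { v∈xs (here refl) → path-∉ ear v∈xs hub∈S
                         ; v∈xs (there v∈ys) → path-∉ ear v∈xs (ys⊆S v∈ys) }))
          hub-is-a : hub ≡ a × (∀ {v} → v ∈ S → v ∈ rim) → ⊥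
          -- Only a wheel is possible here: at a loop the hub lies on the rim, hence in `S`, while
          -- `a` does not.
          hub-is-a (hub≡a , S⊆rim) = [ wheel-timing , (λ (_ , pos≡hub) → S≢a (pos∈S 0) (trans (pos≡hub 0) hub≡a)) ]′ timing
            where
            wheel-timing : N ≡ suc n → ⊥
            wheel-timing N≡1+n =
              -- The walk meets the base of the ear at some `t < m`, so `a` is true at time
              -- `t + length xs`. The next position of the walk is still true and, by its negative
              -- spoke, needs `a` false. Disjointness of ear and rim keeps this within time `N`.
              let (t , t<m , eq) = pos-hits p (S⊆rim (proj₂ (base ear)))
                  ear≤n = subst (λ l → length xs + l ≤ n) rim-length
                    (length-++-unique (path-unique ear) rim-unique λ v∈xs v∈rim → path-∉ ear v∈xs (rim⊆S v∈rim))
                  s<N : t + length xs < N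
                  s<N = subst (t + length xs <_) (sym N≡1+n)
                    (s≤s (≤-trans (+-monoˡ-≤ (length xs) (<⇒≤ t<m)) (subst (_≤ n) (+-comm (length xs) m) ear≤n)))
                  q = pos (p + suc (t + length xs))
                  a-true = delayed t (subst (λ u → at t u ≡ true) eq (alive t (≤-trans (m≤m+n t (length xs)) (<⇒≤ s<N))))
                  a-false = trans (fire⁻ (t + length xs) (alive (suc (t + length xs)) s<N) (subst (λ h → Arc G h q) hub≡a (spoke _)))
                    (sign-false q)
              in contradiction (trans (sym a-true) a-false) λ ()

  nextStage : ∀ {S} → Unique S → (∀ {v} → v ∈ rim → v ∈ S) →
    (∀ {s s′} → s ∈ S → s′ ∈ S → Star (Within S) s s′) → hub ∈ S → ∀ {v} → v ∉ S → ∃[ a ] Stage S a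
  nextStage {S} u r s h v∉S =
    let (a , w , a∉S , w∈S , arc) = entering S (connected _ hub) v∉S h in
    a , record { unique = u ; rim⊆S = r ; strong = s ; a∉S = a∉S ; w = w ; w∈S = w∈S ; exit = arc ; centre = inj₁ h }

  -- Each ear contains `a`, which is outside `S`, so every round gains a vertex. Without fuel, `S`
  -- and `a` together would exceed `n` vertices.
  grow : ∀ fuel {S a} → Stage S a → n ≤ fuel + length S → Goal
  grow zero st n≤ = contradiction (≤-trans (length-unique (∉⇒unique a∉S unique)) n≤) (<-irrefl refl)
    where open Stage st
  grow (suc fuel) {S} {a} st n≤
    with path {R = flip (Arc G)} (Star.reverse id (connected (pos 0) a)) (Stage.rim⊆S st (pos∈rim 0))
  ... | xs , ear with all? (λ v → _∈?_ _≟_ v (xs ++ S))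
  ...   | yes covers = [ last-ear , extra-arc ]′ (toSum (all? λ j → all? λ i → T? (G j i) →-dec H? j i))
    where
    open AddEar st ear
    open Spanning covers
  ...   | no ¬covers =
    let (v , v∉) = ¬∀⟶∃¬ n _ (λ v → _∈?_ _≟_ v (xs ++ S)) ¬covers
        (_ , st′) = nextStage unique′ (∈-++⁺ʳ xs ∘ Stage.rim⊆S st) strong′ hub∈S′ v∉
    in grow fuel st′ (≤-trans n≤ (longer xs a∈xs))
    where
    open AddEar st ear
    longer : ∀ xs → a ∈ xs → suc (fuel + length S) ≤ fuel + length (xs ++ S)
    longer (x ∷ xs) _ = subst (_≤ fuel + suc (length (xs ++ S))) (+-suc fuel (length S))
      (+-monoʳ-≤ fuel (s≤s (subst (length S ≤_) (sym (length-++ xs)) (m≤n+m _ _))))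

  construct : ∀ {S a} → Stage S a → Goal
  construct st = grow n st (m≤m+n n _)

-- Initial stages for a loop and for a wheel

module _ (G : Digraph n) (connected : StronglyConnected G) where

  -- The second vertex guaranteed by `2 ≤ n` lies outside `[ v ]` and lets the first ear be built.
  loop-case : 2 ≤ n → ∀ v → Arc G v v → AdmitsNilpotentOfClass≤ G (n + (n ∸ 1))
  loop-case 2≤n v loop = construct (proj₂ (nextStage ([] ∷ []) id
      (λ { (here refl) (here refl) → ε }) (here refl) (proj₂ (another 2≤n v))))
    where
    loopRim : Rim G 1
    loopRim = record
      { rim = [ v ] ; rim-unique = [] ∷ [] ; rim-length = refl ; pos = λ _ → v ; pos∈rim = λ _ → here refl
      ; pos-arc = λ _ → loop ; pos-hits = λ { _ (here refl) → 0 , s≤s z≤n , refl } ; hub = v ; spoke = λ _ → loop }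
    open Construction G connected loopRim n (inj₂ (refl , λ _ → refl))
    another : ∀ {n} → 2 ≤ n → (v : Fin n) → ∃[ u ] u ∉ [ v ]
    another (s≤s (s≤s _)) zero    = suc zero , λ { (here ()) }
    another (s≤s (s≤s _)) (suc _) = zero , λ { (here ()) }

  -- `m ≤ n` is returned too, since rewriting the bound involves truncated subtraction.
  wheel-case : ∀ m .{{_ : NonZero m}} → Contains G (wheel m) → m ≤ n × AdmitsNilpotentOfClass≤ G (suc n + (n ∸ m))
  wheel-case m (Sub , iso) = m≤n , construct record
      { unique = rim-unique ; rim⊆S = id ; strong = strong ; a∉S = hub∉rim
      ; w = pos 0 ; w∈S = pos∈rim 0 ; exit = spoke 0 ; centre = inj₂ (refl , id) }
    where
    open IsomorphicTo iso
    arc : ∀ h h′ → Arc (wheel m) h h′ → Arc G (φ h) (φ h′)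
    arc h h′ = Subgraph.arcs⊆G Sub ∘ Equivalence.to (arcs⇔ h h′)
    vertex : Fin m → Fin n
    vertex i = φ (suc i)
    toℕ-mod : ∀ q → toℕ (q mod m) ≡ q % m
    toℕ-mod q = toℕ-fromℕ< (m%n<n q m)
    suc-% : ∀ q → suc q % m ≡ suc (q % m) % m
    suc-% q = trans (cong (λ r → suc r % m) (m≡m%n+[m/n]*n q m)) ([m+kn]%n≡m%n (suc (q % m)) (q / m) m)
    hits : ∀ p (i : Fin m) → ∃[ t ] (t < m × (p + t) mod m ≡ i)
    hits p i = t , m%n<n _ m , toℕ-injective (trans (toℕ-mod (p + t)) eq)
      where
      open ≡-Reasoning
      r t : ℕ
      -- `p * (m ∸ 1)` stands for the negative of `p` modulo `m`, so `p + r` is congruent to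
      -- `toℕ i`.
      r = toℕ i + p * (m ∸ 1)
      t = r % m
      p+r : p + r ≡ toℕ i + p * m
      p+r = begin
        p + (toℕ i + p * (m ∸ 1))      ≡⟨ solve 3 (λ p i k → p :+ (i :+ p :* k) := i :+ p :* (con 1 :+ k)) refl p (toℕ i) (m ∸ 1) ⟩
        toℕ i + p * suc (m ∸ 1)        ≡⟨ cong (λ k → toℕ i + p * k) (suc-pred m) ⟩
        toℕ i + p * m                  ∎
        where open +-*-Solver
      eq : (p + t) % m ≡ toℕ i
      eq = begin
        (p + r % m) % m           ≡⟨ %-distribˡ-+ p (r % m) m ⟩
        (p % m + r % m % m) % m   ≡⟨ cong (λ s → (p % m + s) % m) (m%n%n≡m%n r m) ⟩
        (p % m + r % m) % m       ≡⟨ %-distribˡ-+ p r m ⟨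
        (p + r) % m               ≡⟨ cong (_% m) p+r ⟩
        (toℕ i + p * m) % m       ≡⟨ [m+kn]%n≡m%n (toℕ i) p m ⟩
        toℕ i % m                 ≡⟨ m<n⇒m%n≡m (toℕ<n i) ⟩
        toℕ i                     ∎
    wheelRim : Rim G m
    wheelRim = record
      { rim = map vertex (allFin m)
      ; rim-unique = map⁺ (λ eq → suc-injective (injective eq)) (allFin⁺ m)
      ; rim-length = trans (length-map vertex (allFin m)) (length-tabulate id)
      ; pos = λ q → vertex (q mod m)
      ; pos∈rim = λ q → ∈-map⁺ vertex (∈-allFin (q mod m))
      ; pos-arc = λ q → arc (suc (q mod m)) (suc (suc q mod m))
          (≡⇒≡ᵇ _ _ (trans (toℕ-mod (suc q)) (trans (suc-% q) (cong (λ r → suc r % m) (sym (toℕ-mod q))))))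
      ; pos-hits = λ p v∈ →
          let (i , _ , v≡) = ∈-map⁻ vertex v∈ ; (t , t<m , eq) = hits p i
          in t , t<m , trans (cong vertex eq) (sym v≡)
      ; hub = φ zero
      ; spoke = λ q → arc zero (suc (q mod m)) _ }
    open Rim wheelRim
    open Construction G connected wheelRim (suc n) (inj₁ refl)
    m≤n : m ≤ n
    m≤n = subst (_≤ n) rim-length (length-unique rim-unique)
    hub∉rim : hub ∉ rim
    hub∉rim h with ∈-map⁻ vertex h
    ... | _ , _ , eq with injective eq
    ...   | ()
    along : ∀ p t → Star (Within rim) (pos p) (pos (p + t))
    along p zero    = subst (Star (Within rim) (pos p) ∘ pos) (sym (+-identityʳ p)) ε
    along p (suc t) = subst (Star (Within rim) (pos p) ∘ pos) (sym (+-suc p t))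
      (along p t ◅◅ ((pos-arc (p + t) , pos∈rim (p + t) , pos∈rim (suc (p + t))) ◅ ε))
    strong : ∀ {s s′} → s ∈ rim → s′ ∈ rim → Star (Within rim) s s′
    strong s∈ s′∈ with pos-hits 0 s∈
    ... | p , _ , refl with pos-hits p s′∈
    ...   | t , _ , refl = along p t

theorem4 : (n : ℕ) → 2 ≤ n → (G : Digraph n) → StronglyConnected G →
    ((m : ℕ) .{{_ : NonZero m}} → Contains G (wheel m) → AdmitsNilpotentOfClass≤ G (2 * n ∸ m + 1))
    × (HasLoop G → AdmitsNilpotentOfClass≤ G (2 * n ∸ 1))
theorem4 n 2≤n G connected =
    (λ m contains →
      let (m≤n , result) = wheel-case G connected m contains
      in subst (AdmitsNilpotentOfClass≤ G) (wheel-bound m m≤n) result)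
  , (λ (v , loop) → subst (AdmitsNilpotentOfClass≤ G) loop-bound (loop-case G connected 2≤n v loop))
  where
  2n≡n+n : 2 * n ≡ n + n
  2n≡n+n = cong (n +_) (+-identityʳ n)
  wheel-bound : ∀ m → m ≤ n → suc n + (n ∸ m) ≡ 2 * n ∸ m + 1
  wheel-bound m m≤n = trans (cong suc (sym (+-∸-assoc n m≤n)))
    (trans (+-comm 1 (n + n ∸ m)) (cong (λ k → k ∸ m + 1) (sym 2n≡n+n)))
  loop-bound : n + (n ∸ 1) ≡ 2 * n ∸ 1
  loop-bound = trans (sym (+-∸-assoc n (≤-trans (s≤s z≤n) 2≤n))) (cong (_∸ 1) (sym 2n≡n+n))
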